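{- There is a linear-size translation from $\mathrm{FO}_{=}$ formulas into CoR equations preserving validity and finite validity; that is, a computable map $f$ sending each $\mathrm{FO}_{=}$ formula $\varphi$ to a CoR equation $f(\varphi)$ such that $\|f(\varphi)\|$ is bounded by a linear function of $\|\varphi\|$, $\varphi$ is valid if and only if $f(\varphi)$ is valid, and $\varphi$ is finitely valid if and only if $f(\varphi)$ is finitely valid.
   Context: Fix a countably infinite set $\Sigma$ of binary predicate symbols and a countably infinite set $\mathbf{V}$ of variables. A structure $\mathfrak{A}$ over a set $A$ of symbols consists of a non-empty set $|\mathfrak{A}|$ and a binary relation $a^{\mathfrak{A}}\subseteq|\mathfrak{A}|^2$ for each $a\in A$; it is finite if $|\mathfrak{A}|$ is finite. $\mathrm{FO}_{=}$ formulas are given by $\varphi::= a(x,y)\mid x=y\mid \lnot\varphi\mid \varphi\land\psi\mid \exists x,\varphi$ with $a\in\Sigma$, $x,y\in\mathbf{V}$, with the usual Tarskian semantics over structures over $\Sigma$ (under assignments $\mathbf{V}\to|\mathfrak{A}|$). A formula is valid (resp. finitely valid) if it is satisfied by every assignment in every structure (resp. every finite structure) over $\Sigma$. Size: $\|a(x,y)\|=\|x=y\|=3$, $\|\lnot\varphi\|=1+\|\varphi\|$, $\|\varphi\land\psi\|=1+\|\varphi\|+\|\psi\|$, $\|\exists x,\varphi\|=2+\|\varphi\|$. CoR (calculus of relations) terms over $\Sigma$ (elements of $\Sigma$ serve as term variables) are given by $t::=a\mid \mathsf{I}\mid t^{ - }\mid t\cap s\mid t\cdot s\mid t^{\smile}$,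 interpreted in a structure $\mathfrak{A}$ over $\Sigma$ as binary relations on $|\mathfrak{A}|$: $a$ as $a^{\mathfrak{A}}$, $\mathsf{I}$ as the identity relation, $^{ - }$ as complement relative to $|\mathfrak{A}|^2$, $\cap$ as intersection, $\cdot$ as relational composition, $^{\smile}$ as converse. Size: $\|a\|=\|\mathsf{I}\|=1$, each unary operator adds $1$, each binary operator gives $1$ plus the sizes of its arguments. A CoR equation $t=s$ holds in $\mathfrak{A}$ if $t$ and $s$ denote the same relation; it is valid (resp. finitely valid) if it holds in every structure (resp. every finite structure) over $\Sigma$; $\|t=s\|=1+\|t\|+\|s\|$. -}

module Defs where

open import Data.Nat using (ℕ; suc; _+_; _*_; _≤_)
open import Data.Fin using (Fin)
open import Data.Product using (Σ; _×_; _,_)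
open import Data.Empty using (⊥)
open import Relation.Nullary using (¬_)
open import Relation.Binary.PropositionalEquality using (_≡_)
open import Function.Bundles using (_⇔_)

Sym : Set
Sym = ℕ

Var : Set
Var = ℕ

record Structure : Set₁ where
  field
    Carrier : Set
    point   : Carrier                       -- non-emptiness
    rel     : Sym → Carrier → Carrier → Set

open Structure public

-- Finite structures: carrier Fin (suc n) (finite, non-empty), up to isomorphism
-- every finite structure is of this form.
finStructure : (n : ℕ) → (Sym → Fin (suc n) → Fin (suc n) → Set) → Structure
finStructure n r = record { Carrier = Fin (suc n) ; point = Fin.zero ; rel = r }

data Formula : Set where
  atom : Sym → Var → Var → Formula
  eq   : Var → Var → Formula
  neg  : Formula → Formula
  and  : Formula → Formula → Formula
  ex   : Var → Formula → Formula

fsize : Formula → ℕ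
fsize (atom a x y) = 3
fsize (eq x y)     = 3
fsize (neg φ)      = 1 + fsize φ
fsize (and φ ψ)    = 1 + fsize φ + fsize ψ
fsize (ex x φ)     = 2 + fsize φ

_[_↦_] : {A : Set} → (Var → A) → Var → A → (Var → A)
(ρ [ x ↦ d ]) y with Data.Nat._≟_ x y
... | Relation.Nullary.yes _ = d
... | Relation.Nullary.no  _ = ρ y

-- Tarskian satisfaction (classical once excluded middle is assumed)
Sat : (𝔄 : Structure) → (Var → Carrier 𝔄) → Formula → Set
Sat 𝔄 ρ (atom a x y) = rel 𝔄 a (ρ x) (ρ y)
Sat 𝔄 ρ (eq x y)     = ρ x ≡ ρ y
Sat 𝔄 ρ (neg φ)      = ¬ Sat 𝔄 ρ φ
Sat 𝔄 ρ (and φ ψ)    = Sat 𝔄 ρ φ × Sat 𝔄 ρ ψ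
Sat 𝔄 ρ (ex x φ)     = Σ (Carrier 𝔄) λ d → Sat 𝔄 (ρ [ x ↦ d ]) φ

Valid : Formula → Set₁
Valid φ = (𝔄 : Structure) (ρ : Var → Carrier 𝔄) → Sat 𝔄 ρ φ

FinValid : Formula → Set₁
FinValid φ = (n : ℕ) (r : Sym → Fin (suc n) → Fin (suc n) → Set)
             (ρ : Var → Fin (suc n)) → Sat (finStructure n r) ρ φ

data Term : Set where
  var  : Sym → Term
  I    : Term
  comp : Term → Term
  cap  : Term → Term → Term
  dot  : Term → Term → Term
  conv : Term → Term

tsize : Term → ℕ
tsize (var a)   = 1
tsize I         = 1
tsize (comp t)  = 1 + tsize t
tsize (cap t s) = 1 + tsize t + tsize s
tsize (dot t s) = 1 + tsize t + tsize s
tsize (conv t)  = 1 + tsize t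

record Equation : Set where
  constructor _≐_
  field
    lhs rhs : Term

open Equation public

esize : Equation → ℕ
esize (t ≐ s) = 1 + tsize t + tsize s

⟦_⟧ : Term → (𝔄 : Structure) → Carrier 𝔄 → Carrier 𝔄 → Set
⟦ var a ⟧   𝔄 x y = rel 𝔄 a x y
⟦ I ⟧       𝔄 x y = x ≡ y
⟦ comp t ⟧  𝔄 x y = ¬ ⟦ t ⟧ 𝔄 x y
⟦ cap t s ⟧ 𝔄 x y = ⟦ t ⟧ 𝔄 x y × ⟦ s ⟧ 𝔄 x y
⟦ dot t s ⟧ 𝔄 x y = Σ (Carrier 𝔄) λ z → ⟦ t ⟧ 𝔄 x z × ⟦ s ⟧ 𝔄 z y
⟦ conv t ⟧  𝔄 x y = ⟦ t ⟧ 𝔄 y x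

Holds : Structure → Equation → Set
Holds 𝔄 (t ≐ s) = (x y : Carrier 𝔄) → ⟦ t ⟧ 𝔄 x y ⇔ ⟦ s ⟧ 𝔄 x y

EqValid : Equation → Set₁
EqValid e = (𝔄 : Structure) → Holds 𝔄 e

EqFinValid : Equation → Set₁
EqFinValid e = (n : ℕ) (r : Sym → Fin (suc n) → Fin (suc n) → Set) →
               Holds (finStructure n r) e

-- An element w of a structure is read as an assignment whose i-th value is the
-- unique V i-successor of w, the values being the elements marked by D.  The
-- quantifier ∃x becomes composition with E i, "differ at most in slot i".  Making
-- this exact requires all other slots to agree, which the chains P i ("agree
-- below i") and S i ("agree from i on") express with a constant number of axioms
-- per slot, so the axioms are linear in the number of variables.  φ becomes the
-- equation saying that its translation tr φ is total in every model of these
-- axioms.  In a model, the values carry a structure in which the assignment coded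
-- by w satisfies φ iff w is in the domain of tr φ; conversely, the tuples over
-- any structure form a model.  Both constructions preserve finiteness.
module Submission where

open import Defs
open import Data.Nat
  using (ℕ; zero; suc; pred; _+_; _*_; _^_; _≤_; _<_; _≤′_; ≤′-refl; ≤′-step; z≤n; s≤s; _≟_; _<?_)
open import Data.Nat.Properties
  using (≤-refl; <⇒≤; <-trans; <-cmp; <⇒≢; >⇒≢; ≤⇒≤′; m<n⇒m<1+n; m<1+n⇒m<n∨m≡n;
         m^n≢0; suc-pred;
         ≤-trans; m≤n⇒m≤1+n; n<1+n; m≤m+n; m≤n+m; +-mono-≤; +-monoʳ-≤; +-monoˡ-≤; *-monoˡ-≤;
         +-assoc; *-distribʳ-+; module ≤-Reasoning)
open import Data.Fin using (Fin; toℕ; fromℕ<; finToFun; funToFin)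
import Data.Fin as Fin
open import Data.Fin.Properties using (finToFun-funToFin; toℕ-fromℕ<; suc-injective)
open import Data.Bool.Properties using (T-irrelevant)
open import Data.Product using (Σ; _×_; _,_; proj₁; proj₂; uncurry)
open import Data.Sum using ([_,_]′)
open import Data.Empty using (⊥-elim)
open import Data.List using (List; []; _∷_; _++_; length)
open import Data.List.Properties using (length-++)
open import Data.List.Membership.Propositional using (_∈_)
open import Data.List.Relation.Unary.Any using (here; there)
open import Data.List.Relation.Unary.All using (All; []; _∷_)
open import Data.List.Relation.Unary.All.Properties using (++⁺; ++⁻)
open import Data.List.Relation.Binary.Subset.Propositional using (_⊆_)
open import Data.List.Relation.Binary.Subset.Propositional.Properties using (⊆-refl; xs⊆xs++ys; xs⊆ys++xs)
open import Relation.Binary.Definitions using (tri<; tri≈; tri>)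
open import Relation.Binary.PropositionalEquality
open import Relation.Binary.PropositionalEquality.Properties using (subst-subst-sym)
open import Relation.Nullary using (¬_; Dec; yes; no)
open import Relation.Nullary.Decidable using (True; toWitness; fromWitness; decidable-stable)
open import Function using (_∘_)
open import Function.Bundles using (_⇔_; mk⇔; Equivalence)
open import Function.Related.TypeIsomorphisms using (¬-cong-⇔)
open import Data.Product.Function.NonDependent.Propositional using (_×-⇔_)
open import Data.Nat.Tactic.RingSolver using (solve-∀)
open import Axiom.ExcludedMiddle using (ExcludedMiddle)
open import Level using (0ℓ)

infixl 6 _∪_
infixl 7 _∩_
infixl 8 _·_
infix 9 _⁻ _˘

_⁻ _˘ : Term → Term
_⁻ = comp
_˘ = conv

_∩_ _·_ _∪_ : Term → Term → Term
_∩_ = cap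
_·_ = dot
t ∪ s = (t ⁻ ∩ s ⁻) ⁻

empty top : Term
empty = I ∩ I ⁻
top = empty ⁻

top-intro : {A : Set} {x y : A} → ¬ (x ≡ y × ¬ x ≡ y)
top-intro (x≡y , x≢y) = x≢y x≡y

Inclusion : Set
Inclusion = Term × Term

Includes : Structure → Inclusion → Set
Includes B (t , s) = ∀ {x y} → ⟦ t ⟧ B x y → ⟦ s ⟧ B x y

violation : Inclusion → Term
violation (t , s) = t ∩ s ⁻

anyViolation : List Inclusion → Term
anyViolation []         = empty
anyViolation (ax ∷ axs) = violation ax ∪ anyViolation axs

includes⇒no-violation : ∀ {B} axs → All (Includes B) axs →
                        ∀ {x y} → ¬ ⟦ anyViolation axs ⟧ B x y
includes⇒no-violation []       []           = top-intro
includes⇒no-violation (_ ∷ axs) (inc ∷ incs) violated =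
  violated ((λ { (p , ¬q) → ¬q (inc p) }) , includes⇒no-violation axs incs)

no-violation⇒includes : ExcludedMiddle 0ℓ → ∀ {B} axs →
                        (∀ {x y} → ¬ ⟦ anyViolation axs ⟧ B x y) → All (Includes B) axs
no-violation⇒includes lem []        _  = []
no-violation⇒includes lem (_ ∷ axs) nv =
  (λ p → decidable-stable lem λ ¬q → nv λ { (¬violated , _) → ¬violated (p , ¬q) })
  ∷ no-violation⇒includes lem axs λ violated → nv λ { (_ , ¬rest) → ¬rest violated }

-- Holds in B iff t is total in B whenever B satisfies axs (classically).
guarded : List Inclusion → Term → Equation
guarded axs t = ((top · anyViolation axs · top) ⁻ ∩ t ⁻) ≐ empty

guarded-intro : ExcludedMiddle 0ℓ → ∀ {B} axs t →
                (All (Includes B) axs → ∀ x y → ⟦ t ⟧ B x y) → Holds B (guarded axs t)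
guarded-intro lem {B} axs t total x y = mk⇔ to (⊥-elim ∘ top-intro)
  where
  to : ⟦ (top · anyViolation axs · top) ⁻ ∩ t ⁻ ⟧ B x y → ⟦ empty ⟧ B x y
  to (¬violated , ¬t) = ⊥-elim (¬t (total axs-hold x y))
    where
    axs-hold : All (Includes B) axs
    axs-hold = no-violation⇒includes lem axs
                 λ {u} {u'} v → ¬violated (u' , (u , top-intro , v) , top-intro)

guarded-elim : ∀ {B} axs t → Holds B (guarded axs t) → All (Includes B) axs →
               ∀ x y → ¬ ¬ ⟦ t ⟧ B x y
guarded-elim {B} axs t holds axs-hold x y ¬t = top-intro (Equivalence.to (holds x y) (no-violation , ¬t))
  where
  no-violation : ¬ ⟦ top · anyViolation axs · top ⟧ B x y
  no-violation (_ , (_ , _ , v) , _) = includes⇒no-violation axs axs-hold v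

data Kind : Set where
  atomic valuation variant prefix suffix domain : Kind

tag : Kind → ℕ
tag atomic    = 0
tag valuation = 1
tag variant   = 2
tag prefix    = 3
tag suffix    = 4
tag domain    = 5

code : Kind → ℕ → Sym
code k zero    = tag k
code k (suc i) = 6 + code k i

decode : Sym → Kind × ℕ
decode 0 = atomic , 0
decode 1 = valuation , 0
decode 2 = variant , 0
decode 3 = prefix , 0
decode 4 = suffix , 0
decode 5 = domain , 0
decode (suc (suc (suc (suc (suc (suc s)))))) = proj₁ (decode s) , suc (proj₂ (decode s))

decode-code : ∀ k i → decode (code k i) ≡ (k , i)
decode-code atomic    zero = refl
decode-code valuation zero = refl
decode-code variant   zero = refl
decode-code prefix    zero = refl
decode-code suffix    zero = refl
decode-code domain    zero = refl
decode-code k (suc i) rewrite decode-code k i = refl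

R : Sym → Term
R a = var (code atomic a)

V E P S : ℕ → Term
V i = var (code valuation i)
E i = var (code variant i)
P i = var (code prefix i)
S i = var (code suffix i)

D : Term
D = var (code domain 0)

values : Term
values = (D · top) ˘

sameValue : ℕ → Term
sameValue i = V i · V i ˘

IsValue : (B : Structure) → Carrier B → Set
IsValue B v = Σ (Carrier B) (rel B (code domain 0) v)

indexAxioms : ℕ → List Inclusion
indexAxioms i =
    (V i , values)
  ∷ (V i ˘ · V i , I)
  ∷ (top , V i · top)
  ∷ (P (suc i) , P i ∩ sameValue i)
  ∷ (S i , S (suc i) ∩ sameValue i)
  ∷ (E i , P i ∩ S (suc i))
  ∷ (values , E i · V i)
  ∷ []

valuesExist : Inclusion
valuesExist = top , top · D · top

axioms : ℕ → List Inclusion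
axioms zero    = valuesExist ∷ []
axioms (suc k) = indexAxioms k ++ axioms k

record IndexLaws (B : Structure) (i : ℕ) : Set where
  field
    V-values     : Includes B (V i , values)
    V-functional : Includes B (V i ˘ · V i , I)
    V-total      : Includes B (top , V i · top)
    P-step       : Includes B (P (suc i) , P i ∩ sameValue i)
    S-step       : Includes B (S i , S (suc i) ∩ sameValue i)
    E-split      : Includes B (E i , P i ∩ S (suc i))
    E-reach      : Includes B (values , E i · V i)

record Laws (M : ℕ) (B : Structure) : Set where
  field
    index-laws   : ∀ {i} → i < M → IndexLaws B i
    values-exist : Includes B valuesExist

value-exists : ∀ {M B} → Laws M B → Σ (Carrier B) (IsValue B)
value-exists {B = B} laws with Laws.values-exist laws {point B} {point B} top-intro
... | _ , (v , _ , Dvz) , _ = v , _ , Dvz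

axioms⇒laws : ∀ {B} M → All (Includes B) (axioms M) → Laws M B
axioms⇒laws zero (exist ∷ []) = record { index-laws = λ () ; values-exist = exist }
axioms⇒laws (suc k) axs-hold with ++⁻ (indexAxioms k) axs-hold
... | V₁ ∷ V₂ ∷ V₃ ∷ P₁ ∷ S₁ ∷ E₁ ∷ E₂ ∷ [] , rest = record
  { index-laws   = λ i<1+k → [ Laws.index-laws laws , (λ { refl → now }) ]′ (m<1+n⇒m<n∨m≡n i<1+k)
  ; values-exist = Laws.values-exist laws
  }
  where
  laws = axioms⇒laws k rest
  now = record { V-values = V₁ ; V-functional = V₂ ; V-total = V₃ ; P-step = P₁
               ; S-step = S₁ ; E-split = E₁ ; E-reach = E₂ }

laws⇒axioms : ∀ {B} M → Laws M B → All (Includes B) (axioms M)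
laws⇒axioms zero laws = Laws.values-exist laws ∷ []
laws⇒axioms (suc k) laws = ++⁺ now (laws⇒axioms k earlier)
  where
  open IndexLaws (Laws.index-laws laws ≤-refl)
  now = V-values ∷ V-functional ∷ V-total ∷ P-step ∷ S-step ∷ E-split ∷ E-reach ∷ []
  earlier = record { index-laws   = λ i<k → Laws.index-laws laws (m<n⇒m<1+n i<k)
                   ; values-exist = Laws.values-exist laws }

vars : Formula → List Var
vars (atom a x y) = x ∷ y ∷ []
vars (eq x y)     = x ∷ y ∷ []
vars (neg φ)      = vars φ
vars (and φ ψ)    = vars φ ++ vars ψ
vars (ex x φ)     = x ∷ vars φ

indexOf : List Var → Var → ℕ
indexOf []      x = 0
indexOf (z ∷ L) x with z ≟ x
... | yes _ = 0
... | no  _ = suc (indexOf L x)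

-- Out of range indices give the junk variable 0.
nth : List Var → ℕ → Var
nth []      _       = 0
nth (z ∷ L) zero    = z
nth (z ∷ L) (suc k) = nth L k

indexOf≤length : ∀ L x → indexOf L x ≤ length L
indexOf≤length []      x = z≤n
indexOf≤length (z ∷ L) x with z ≟ x
... | yes _ = z≤n
... | no  _ = s≤s (indexOf≤length L x)

nth-indexOf : ∀ {L x} → x ∈ L → nth L (indexOf L x) ≡ x
nth-indexOf {z ∷ L} {x} x∈L with z ≟ x | x∈L
... | yes z≡x | _         = z≡x
... | no  z≢x | here x≡z  = ⊥-elim (z≢x (sym x≡z))
... | no  _   | there x∈L = nth-indexOf x∈L

indexOf-injective : ∀ {L x y} → x ∈ L → y ∈ L → indexOf L x ≡ indexOf L y → x ≡ y
indexOf-injective {L} x∈L y∈L same =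
  trans (sym (nth-indexOf x∈L)) (trans (cong (nth L) same) (nth-indexOf y∈L))

update-cong : ∀ {A : Set} {ρ σ : Var → A} x d {y} → ρ y ≡ σ y → (ρ [ x ↦ d ]) y ≡ (σ [ x ↦ d ]) y
update-cong x d {y} agree with x ≟ y
... | yes _ = refl
... | no  _ = agree

update-≡ : ∀ {A : Set} (ρ : Var → A) x d → (ρ [ x ↦ d ]) x ≡ d
update-≡ ρ x d with x ≟ x
... | yes _   = refl
... | no  x≢x = ⊥-elim (x≢x refl)

update-≢ : ∀ {A : Set} (ρ : Var → A) {x} d {y} → x ≢ y → (ρ [ x ↦ d ]) y ≡ ρ y
update-≢ ρ {x} d {y} x≢y with x ≟ y
... | yes x≡y = ⊥-elim (x≢y x≡y)
... | no  _   = refl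

Sat-cong : ∀ {A} ψ {ρ σ : Var → Carrier A} → (∀ {y} → y ∈ vars ψ → ρ y ≡ σ y) →
           Sat A ρ ψ → Sat A σ ψ
Sat-cong {A} (atom a x y) agree s = subst₂ (rel A a) (agree (here refl)) (agree (there (here refl))) s
Sat-cong (eq x y)  agree s = trans (sym (agree (here refl))) (trans s (agree (there (here refl))))
Sat-cong (neg ψ)   agree s = s ∘ Sat-cong ψ (sym ∘ agree)
Sat-cong (and ψ χ) agree (s , t) =
  Sat-cong ψ (agree ∘ xs⊆xs++ys _ _) s , Sat-cong χ (agree ∘ xs⊆ys++xs _ (vars ψ)) t
Sat-cong (ex x ψ)  agree (d , s) = d , Sat-cong ψ (update-cong x d ∘ agree ∘ there) s

-- Elements of B code M-tuples over A: coord w i is the value read off w along V i.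
record Coding (M : ℕ) (A B : Structure) : Set where
  field
    embed           : Carrier A → Carrier B
    embed-injective : ∀ {c c'} → embed c ≡ embed c' → c ≡ c'
    coord           : Carrier B → (i : ℕ) → i < M → Carrier A
    V-coord         : ∀ {i} (i<M : i < M) w → ⟦ V i ⟧ B w (embed (coord w i i<M))
    V-unique        : ∀ {i} (i<M : i < M) {w v} → ⟦ V i ⟧ B w v → v ≡ embed (coord w i i<M)
    R-embed         : ∀ a {c c'} → rel A a c c' → ⟦ R a ⟧ B (embed c) (embed c')
    R-embed⁻        : ∀ a {c c'} → ⟦ R a ⟧ B (embed c) (embed c') → rel A a c c'
    E-coord         : ∀ {i} → i < M → ∀ {w w'} → ⟦ E i ⟧ B w w' →
                      ∀ {j} (j<M : j < M) → j ≢ i → coord w j j<M ≡ coord w' j j<M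
    E-reach         : ∀ {i} (i<M : i < M) w c →
                      Σ (Carrier B) λ w' → ⟦ E i ⟧ B w w' × coord w' i i<M ≡ c

tr : List Var → Formula → Term
tr L (atom a x y) = (V (indexOf L x) · R a ∩ V (indexOf L y)) · top
tr L (eq x y)     = (V (indexOf L x) ∩ V (indexOf L y)) · top
tr L (neg φ)      = tr L φ ⁻
tr L (and φ ψ)    = tr L φ ∩ tr L ψ
tr L (ex x φ)     = E (indexOf L x) · tr L φ

module Correctness {L : List Var} {A B : Structure} (𝒞 : Coding (suc (length L)) A B) where
  open Coding 𝒞

  slot< : ∀ x → indexOf L x < suc (length L)
  slot< x = s≤s (indexOf≤length L x)

  assignment : Carrier B → Var → Carrier A
  assignment w x = coord w (indexOf L x) (slot< x)

  E-assignment : ∀ {x y w w'} → ⟦ E (indexOf L x) ⟧ B w w' → x ∈ L → y ∈ L →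
                 (assignment w [ x ↦ assignment w' x ]) y ≡ assignment w' y
  E-assignment {x} {y} e x∈L y∈L with x ≟ y
  ... | yes refl = refl
  ... | no  x≢y  = E-coord (slot< x) e (slot< y) (x≢y ∘ sym ∘ indexOf-injective y∈L x∈L)

  tr-correct : ∀ ψ → vars ψ ⊆ L → ∀ w z → ⟦ tr L ψ ⟧ B w z ⇔ Sat A (assignment w) ψ
  tr-correct (atom a x y) _ w z = mk⇔ to from
    where
    to : ⟦ tr L (atom a x y) ⟧ B w z → Sat A (assignment w) (atom a x y)
    to (u , ((v , Vxv , Rvu) , Vyu) , _) =
      R-embed⁻ a (subst₂ (⟦ R a ⟧ B) (V-unique (slot< x) Vxv) (V-unique (slot< y) Vyu) Rvu)
    from : Sat A (assignment w) (atom a x y) → ⟦ tr L (atom a x y) ⟧ B w z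
    from s = _ , ((_ , V-coord (slot< x) w , R-embed a s) , V-coord (slot< y) w) , top-intro
  tr-correct (eq x y) _ w z = mk⇔ to from
    where
    to : ⟦ tr L (eq x y) ⟧ B w z → Sat A (assignment w) (eq x y)
    to (v , (Vxv , Vyv) , _) =
      embed-injective (trans (sym (V-unique (slot< x) Vxv)) (V-unique (slot< y) Vyv))
    from : Sat A (assignment w) (eq x y) → ⟦ tr L (eq x y) ⟧ B w z
    from s = _ , (V-coord (slot< x) w ,
                  subst (λ c → ⟦ V (indexOf L y) ⟧ B w (embed c)) (sym s) (V-coord (slot< y) w)) ,
             top-intro
  tr-correct (neg ψ) sub w z = ¬-cong-⇔ (tr-correct ψ sub w z)
  tr-correct (and ψ χ) sub w z =
    tr-correct ψ (sub ∘ xs⊆xs++ys _ _) w z ×-⇔ tr-correct χ (sub ∘ xs⊆ys++xs _ (vars ψ)) w z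
  tr-correct (ex x ψ) sub w z = mk⇔ to from
    where
    IH : ∀ w' → ⟦ tr L ψ ⟧ B w' z ⇔ Sat A (assignment w') ψ
    IH w' = tr-correct ψ (sub ∘ there) w' z
    agree : ∀ {w'} → ⟦ E (indexOf L x) ⟧ B w w' → ∀ {y} → y ∈ vars ψ →
            (assignment w [ x ↦ assignment w' x ]) y ≡ assignment w' y
    agree e y∈ψ = E-assignment e (sub (here refl)) (sub (there y∈ψ))
    to : ⟦ tr L (ex x ψ) ⟧ B w z → Sat A (assignment w) (ex x ψ)
    to (w' , e , t) = _ , Sat-cong ψ (sym ∘ agree e) (Equivalence.to (IH w') t)
    from : Sat A (assignment w) (ex x ψ) → ⟦ tr L (ex x ψ) ⟧ B w z
    from (c , s) with E-reach (slot< x) w c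
    ... | w' , e , refl = w' , e , Equivalence.from (IH w') (Sat-cong ψ (agree e) s)

record Enumeration {A : Set} (C : Set) (P : A → Set) : Set where
  field
    enum           : C → A
    enum-injective : ∀ {c c'} → enum c ≡ enum c' → c ≡ c'
    enum-sat       : ∀ c → P (enum c)
    enum-onto      : ∀ {a} → P a → Σ C λ c → enum c ≡ a

valueStructure : (B : Structure) {C : Set} → Enumeration C (IsValue B) → C → Structure
valueStructure B {C} e c₀ = record
  { Carrier = C ; point = c₀ ; rel = λ a c c' → rel B (code atomic a) (enum c) (enum c') }
  where open Enumeration e

module Values {M} {B : Structure} (laws : Laws M B) {C : Set} (e : Enumeration C (IsValue B)) (c₀ : C) where
  open Enumeration e
  open Laws laws
  module Law {i} (i<M : i < M) = IndexLaws (index-laws i<M)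

  successor : ∀ {i} → i < M → ∀ w → Σ (Carrier B) (⟦ V i ⟧ B w)
  successor i<M w with Law.V-total i<M {w} {w} top-intro
  ... | v , Vwv , _ = v , Vwv

  successor-value : ∀ {i} (i<M : i < M) {w v} → ⟦ V i ⟧ B w v → IsValue B v
  successor-value i<M Vwv with Law.V-values i<M Vwv
  ... | z , Dvz , _ = z , Dvz

  coord : Carrier B → (i : ℕ) → i < M → C
  coord w i i<M = proj₁ (enum-onto (successor-value i<M (proj₂ (successor i<M w))))

  enum-coord : ∀ {i} (i<M : i < M) w → enum (coord w i i<M) ≡ proj₁ (successor i<M w)
  enum-coord i<M w = proj₂ (enum-onto (successor-value i<M (proj₂ (successor i<M w))))

  V-unique : ∀ {i} (i<M : i < M) {w v} → ⟦ V i ⟧ B w v → v ≡ enum (coord w i i<M)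
  V-unique i<M {w} Vwv =
    trans (Law.V-functional i<M (w , Vwv , proj₂ (successor i<M w))) (sym (enum-coord i<M w))

  P-descend : ∀ {i j w w'} → j ≤′ i → i ≤ M → ⟦ P i ⟧ B w w' → ⟦ P j ⟧ B w w'
  P-descend ≤′-refl            _      p = p
  P-descend (≤′-step j≤′i) 1+i≤M p = P-descend j≤′i (<⇒≤ 1+i≤M) (proj₁ (Law.P-step 1+i≤M p))

  S-ascend : ∀ {i j w w'} → i ≤′ j → j ≤ M → ⟦ S i ⟧ B w w' → ⟦ S j ⟧ B w w'
  S-ascend ≤′-refl            _      s = s
  S-ascend (≤′-step i≤′j) 1+j≤M s = proj₁ (Law.S-step 1+j≤M (S-ascend i≤′j (<⇒≤ 1+j≤M) s))

  E-sameValue : ∀ {i j w w'} → i < M → ⟦ E i ⟧ B w w' → j < M → j ≢ i → ⟦ sameValue j ⟧ B w w'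
  E-sameValue {i} {j} i<M e j<M j≢i with Law.E-split i<M e | <-cmp j i
  ... | p , _ | tri< j<i _ _ = proj₂ (Law.P-step (<-trans j<i i<M) (P-descend (≤⇒≤′ j<i) (<⇒≤ i<M) p))
  ... | _     | tri≈ _ j≡i _ = ⊥-elim (j≢i j≡i)
  ... | _ , s | tri> _ _ i<j = proj₂ (Law.S-step j<M (S-ascend (≤⇒≤′ i<j) (<⇒≤ j<M) s))

  coding : Coding M (valueStructure B e c₀) B
  coding = record
    { embed           = enum
    ; embed-injective = enum-injective
    ; coord           = coord
    ; V-coord         = λ {i} i<M w → subst (⟦ V i ⟧ B w) (sym (enum-coord i<M w)) (proj₂ (successor i<M w))
    ; V-unique        = V-unique
    ; R-embed         = λ _ r → r
    ; R-embed⁻        = λ _ r → r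
    ; E-coord         = E-coord
    ; E-reach         = E-reach
    }
    where
    E-coord : ∀ {i} → i < M → ∀ {w w'} → ⟦ E i ⟧ B w w' →
              ∀ {j} (j<M : j < M) → j ≢ i → coord w j j<M ≡ coord w' j j<M
    E-coord i<M e j<M j≢i with E-sameValue i<M e j<M j≢i
    ... | v , Vwv , Vw'v = enum-injective (trans (sym (V-unique j<M Vwv)) (V-unique j<M Vw'v))
    E-reach : ∀ {i} (i<M : i < M) w c → Σ (Carrier B) λ w' → ⟦ E i ⟧ B w w' × coord w' i i<M ≡ c
    E-reach i<M w c with enum-sat c
    ... | z , Dcz with Law.E-reach i<M (z , Dcz , top-intro)
    ...   | w' , e , Vw'c = w' , e , enum-injective (sym (V-unique i<M Vw'c))

record TupleCode (M : ℕ) (A W : Set) : Set where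
  field
    get     : W → ℕ → A
    put     : (ℕ → A) → W
    get-put : ∀ f {i} → i < M → get (put f) i ≡ f i

module Worlds {m : ℕ} (A : Structure) {W : Set} (T : TupleCode (suc m) (Carrier A) W) (w₀ : W) where
  open TupleCode T

  M : ℕ
  M = suc m

  embed : Carrier A → W
  embed d = put λ _ → d

  get-embed : ∀ d → get (embed d) 0 ≡ d
  get-embed d = get-put (λ _ → d) (s≤s z≤n)

  set : W → ℕ → Carrier A → W
  set w i d = put (get w [ i ↦ d ])

  get-set-≡ : ∀ w {i} d → i < M → get (set w i d) i ≡ d
  get-set-≡ w {i} d i<M = trans (get-put _ i<M) (update-≡ (get w) i d)

  get-set-≢ : ∀ w {i} d {j} → j < M → i ≢ j → get (set w i d) j ≡ get w j
  get-set-≢ w d j<M i≢j = trans (get-put _ j<M) (update-≢ (get w) d i≢j)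

  -- Values are the constant tuples; atomic relations compare slot 0.
  Interp : Kind → ℕ → W → W → Set
  Interp atomic    a v v' = rel A a (get v 0) (get v' 0)
  Interp valuation i w v  = v ≡ embed (get w i)
  Interp variant   i w w' = ∀ {j} → j < M → j ≢ i → get w j ≡ get w' j
  Interp prefix    i w w' = ∀ {j} → j < i → get w j ≡ get w' j
  Interp suffix    i w w' = ∀ {j} → i ≤ j → j < M → get w j ≡ get w' j
  Interp domain    _ v _  = Σ (Carrier A) λ d → v ≡ embed d

  worlds : Structure
  worlds = record { Carrier = W ; point = w₀ ; rel = λ s → uncurry Interp (decode s) }

  fold : ∀ k i {w w'} → Interp k i w w' → rel worlds (code k i) w w'
  fold k i = subst (λ p → uncurry Interp p _ _) (sym (decode-code k i))

  unfold : ∀ k i {w w'} → rel worlds (code k i) w w' → Interp k i w w'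
  unfold k i = subst (λ p → uncurry Interp p _ _) (decode-code k i)

  sameValue-intro : ∀ {i w w'} → get w i ≡ get w' i → ⟦ sameValue i ⟧ worlds w w'
  sameValue-intro {i} same = _ , fold valuation i refl , fold valuation i (cong embed same)

  variant-set : ∀ w i d → ⟦ E i ⟧ worlds w (set w i d)
  variant-set w i d = fold variant i λ j<M j≢i → sym (get-set-≢ w d j<M (j≢i ∘ sym))

  index-laws : ∀ {i} → i < M → IndexLaws worlds i
  index-laws {i} i<M = record
    { V-values     = λ {w} Vwv → w , (_ , unfold valuation i Vwv) , top-intro
    ; V-functional = λ { (_ , Vzv , Vzv') → trans (unfold valuation i Vzv) (sym (unfold valuation i Vzv')) }
    ; V-total      = λ _ → _ , fold valuation i refl , top-intro
    ; P-step       = λ p → fold prefix i (unfold prefix (suc i) p ∘ m<n⇒m<1+n)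
                         , sameValue-intro (unfold prefix (suc i) p ≤-refl)
    ; S-step       = λ s → fold suffix (suc i) (unfold suffix i s ∘ <⇒≤)
                         , sameValue-intro (unfold suffix i s ≤-refl i<M)
    ; E-split      = λ e → fold prefix i (λ j<i → unfold variant i e (<-trans j<i i<M) (<⇒≢ j<i))
                         , fold suffix (suc i) (λ i<j j<M → unfold variant i e j<M (>⇒≢ i<j))
    ; E-reach      = λ { {w} (z , Dvz , _) → reach w Dvz }
    }
    where
    reach : ∀ w {v} → Σ (Carrier A) (λ d → v ≡ embed d) → ⟦ E i · V i ⟧ worlds w v
    reach w (d , refl) = set w i d , variant-set w i d , fold valuation i (cong embed (sym (get-set-≡ w d i<M)))

  laws : Laws M worlds
  laws = record
    { index-laws   = index-laws
    ; values-exist = λ {w} _ → w , (embed (get w 0) , top-intro , (_ , refl)) , top-intro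
    }

  coding : Coding M A worlds
  coding = record
    { embed           = embed
    ; embed-injective = λ {c} {c'} same →
                          trans (sym (get-embed c)) (trans (cong (λ w → get w 0) same) (get-embed c'))
    ; coord           = λ w i _ → get w i
    ; V-coord         = λ {i} _ _ → fold valuation i refl
    ; V-unique        = λ {i} _ → unfold valuation i
    ; R-embed         = λ a r → fold atomic a (subst₂ (rel A a) (sym (get-embed _)) (sym (get-embed _)) r)
    ; R-embed⁻        = λ a r → subst₂ (rel A a) (get-embed _) (get-embed _) (unfold atomic a r)
    ; E-coord         = λ {i} _ → unfold variant i
    ; E-reach         = λ {i} i<M w d → set w i d , variant-set w i d , get-set-≡ w d i<M
    }

Σ-enumeration : ∀ {A : Set} {P : A → Set} (P? : ∀ a → Dec (P a)) →
                Enumeration (Σ A λ a → True (P? a)) P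
Σ-enumeration P? = record
  { enum           = proj₁
  ; enum-injective = λ { {a , t} {.a , t'} refl → cong (a ,_) (T-irrelevant t t') }
  ; enum-sat       = λ (_ , t) → toWitness t
  ; enum-onto      = λ {a} p → (a , fromWitness p) , refl
  }

fin-enumeration : ∀ {K} {P : Fin K → Set} → (∀ a → Dec (P a)) → Σ ℕ λ k → Enumeration (Fin k) P
fin-enumeration {zero} _ = 0 , record
  { enum = λ () ; enum-injective = λ { {()} } ; enum-sat = λ () ; enum-onto = λ { {()} } }
fin-enumeration {suc K} {P} P? with fin-enumeration (P? ∘ Fin.suc) | P? Fin.zero
... | k , e | yes P0 = suc k , record
  { enum = enum′ ; enum-injective = injective _ _ ; enum-sat = sat ; enum-onto = onto _ }
  where
  open Enumeration e
  enum′ : Fin (suc k) → Fin (suc K)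
  enum′ Fin.zero    = Fin.zero
  enum′ (Fin.suc c) = Fin.suc (enum c)
  injective : ∀ c c' → enum′ c ≡ enum′ c' → c ≡ c'
  injective Fin.zero    Fin.zero     _    = refl
  injective (Fin.suc c) (Fin.suc c') same = cong Fin.suc (enum-injective (suc-injective same))
  sat : ∀ c → P (enum′ c)
  sat Fin.zero    = P0
  sat (Fin.suc c) = enum-sat c
  onto : ∀ a → P a → Σ (Fin (suc k)) λ c → enum′ c ≡ a
  onto Fin.zero    _  = Fin.zero , refl
  onto (Fin.suc a) Pa = Fin.suc (proj₁ (enum-onto Pa)) , cong Fin.suc (proj₂ (enum-onto Pa))
... | k , e | no ¬P0 = k , record
  { enum = Fin.suc ∘ enum ; enum-injective = enum-injective ∘ suc-injective
  ; enum-sat = enum-sat ; enum-onto = onto _ }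
  where
  open Enumeration e
  onto : ∀ a → P a → Σ (Fin k) λ c → Fin.suc (enum c) ≡ a
  onto Fin.zero    P0 = ⊥-elim (¬P0 P0)
  onto (Fin.suc a) Pa = proj₁ (enum-onto Pa) , cong Fin.suc (proj₂ (enum-onto Pa))

functionTuples : ∀ {M} {A : Set} → TupleCode M A (ℕ → A)
functionTuples = record { get = λ f → f ; put = λ f → f ; get-put = λ _ _ → refl }

finTuples : ∀ M n → Σ ℕ λ N → TupleCode M (Fin (suc n)) (Fin (suc N))
finTuples M n = pred (suc n ^ M) , record { get = get ; put = put ; get-put = get-put }
  where
  instance
    _ = m^n≢0 (suc n) M
  K≡ : suc (pred (suc n ^ M)) ≡ suc n ^ M
  K≡ = suc-pred (suc n ^ M)
  get : Fin (suc (pred (suc n ^ M))) → ℕ → Fin (suc n)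
  get w i with i <? M
  ... | yes i<M = finToFun (subst Fin K≡ w) (fromℕ< i<M)
  ... | no  _   = Fin.zero
  put : (ℕ → Fin (suc n)) → Fin (suc (pred (suc n ^ M)))
  put f = subst Fin (sym K≡) (funToFin λ (j : Fin M) → f (toℕ j))
  get-put : ∀ f {i} → i < M → get (put f) i ≡ f i
  get-put f {i} i<M with i <? M
  ... | no  i≮M = ⊥-elim (i≮M i<M)
  ... | yes i<M = begin
    finToFun (subst Fin K≡ (subst Fin (sym K≡) (funToFin {M} λ j → f (toℕ j)))) (fromℕ< i<M)
      ≡⟨ cong (λ w → finToFun w (fromℕ< i<M)) (subst-subst-sym K≡) ⟩
    finToFun (funToFin {M} λ j → f (toℕ j)) (fromℕ< i<M)
      ≡⟨ finToFun-funToFin {M} (λ j → f (toℕ j)) (fromℕ< i<M) ⟩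
    f (toℕ (fromℕ< i<M))
      ≡⟨ cong f (toℕ-fromℕ< i<M) ⟩
    f i ∎
    where open ≡-Reasoning

arity : Formula → ℕ
arity φ = suc (length (vars φ))

translation : Formula → Equation
translation φ = guarded (axioms (arity φ)) (tr (vars φ) φ)

length-vars≤fsize : ∀ φ → length (vars φ) ≤ fsize φ
length-vars≤fsize (atom a x y) = s≤s (s≤s z≤n)
length-vars≤fsize (eq x y)     = s≤s (s≤s z≤n)
length-vars≤fsize (neg φ)      = m≤n⇒m≤1+n (length-vars≤fsize φ)
length-vars≤fsize (and φ ψ)    = begin
  length (vars φ ++ vars ψ)     ≡⟨ length-++ (vars φ) ⟩
  length (vars φ) + length (vars ψ) ≤⟨ +-mono-≤ (length-vars≤fsize φ) (length-vars≤fsize ψ) ⟩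
  fsize φ + fsize ψ             <⟨ n<1+n _ ⟩
  fsize (and φ ψ)               ∎
  where open ≤-Reasoning
length-vars≤fsize (ex x φ)     = s≤s (m≤n⇒m≤1+n (length-vars≤fsize φ))

tr-size : ∀ L φ → tsize (tr L φ) ≤ fsize φ * 4
tr-size L (atom a x y) = m≤m+n 11 1
tr-size L (eq x y)     = m≤m+n 9 3
tr-size L (neg φ)      = s≤s (≤-trans (tr-size L φ) (m≤n+m _ 3))
tr-size L (and φ ψ)    = s≤s (begin
  tsize (tr L φ) + tsize (tr L ψ) ≤⟨ +-mono-≤ (tr-size L φ) (tr-size L ψ) ⟩
  fsize φ * 4 + fsize ψ * 4       ≡⟨ *-distribʳ-+ 4 (fsize φ) (fsize ψ) ⟨
  (fsize φ + fsize ψ) * 4         ≤⟨ m≤n+m _ 3 ⟩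
  3 + (fsize φ + fsize ψ) * 4     ∎)
  where open ≤-Reasoning
tr-size L (ex x φ)     = s≤s (s≤s (≤-trans (tr-size L φ) (m≤n+m _ 6)))

anyViolation-axioms-size : ∀ k → tsize (anyViolation (axioms k)) ≡ k * 97 + 28
anyViolation-axioms-size zero    = refl
anyViolation-axioms-size (suc k) =
  trans (cong (97 +_) (anyViolation-axioms-size k)) (sym (+-assoc 97 (k * 97) 28))

esize-guarded : ∀ axs t → esize (guarded axs t) ≡ 20 + tsize (anyViolation axs) + tsize t
esize-guarded axs t = arith (tsize (anyViolation axs)) (tsize t)
  where
  arith : ∀ u s → 1 + (1 + (1 + (1 + (1 + 5 + u) + 5)) + (1 + s)) + 4 ≡ 20 + u + s
  arith = solve-∀

translation-size : ∀ φ → esize (translation φ) ≤ 101 * fsize φ + 145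
translation-size φ = begin
  esize (translation φ)
    ≡⟨ esize-guarded (axioms (arity φ)) (tr (vars φ) φ) ⟩
  20 + tsize (anyViolation (axioms (arity φ))) + tsize (tr (vars φ) φ)
    ≡⟨ cong (λ u → 20 + u + tsize (tr (vars φ) φ)) (anyViolation-axioms-size (arity φ)) ⟩
  20 + (arity φ * 97 + 28) + tsize (tr (vars φ) φ)
    ≤⟨ +-mono-≤ (+-monoʳ-≤ 20 (+-monoˡ-≤ 28 (*-monoˡ-≤ 97 (s≤s (length-vars≤fsize φ)))))
                (tr-size (vars φ) φ) ⟩
  20 + (suc (fsize φ) * 97 + 28) + fsize φ * 4
    ≡⟨ arith (fsize φ) ⟩
  101 * fsize φ + 145 ∎
  where
  open ≤-Reasoning
  arith : ∀ f → 20 + (suc f * 97 + 28) + f * 4 ≡ 101 * f + 145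
  arith = solve-∀

translation-holds : ExcludedMiddle 0ℓ → ∀ φ B →
                    (Laws (arity φ) B → Σ Structure λ A → Coding (arity φ) A B × ∀ ρ → Sat A ρ φ) →
                    Holds B (translation φ)
translation-holds lem φ B model = guarded-intro lem (axioms (arity φ)) (tr (vars φ) φ) λ axs-hold x y →
  let A , 𝒞 , φ-holds = model (axioms⇒laws _ axs-hold)
  in Equivalence.from (Correctness.tr-correct {vars φ} 𝒞 φ ⊆-refl x y) (φ-holds _)

translation-holds⇒¬¬Sat : ∀ φ {A B} (𝒞 : Coding (arity φ) A B) → Laws (arity φ) B →
                      Holds B (translation φ) → ∀ w → ¬ ¬ Sat A (Correctness.assignment {vars φ} 𝒞 w) φ
translation-holds⇒¬¬Sat φ 𝒞 laws holds w ¬sat =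
  guarded-elim (axioms (arity φ)) (tr (vars φ) φ) holds (laws⇒axioms _ laws) w w
    (¬sat ∘ Equivalence.to (Correctness.tr-correct {vars φ} 𝒞 φ ⊆-refl w w))

valid⇒translation-valid : ExcludedMiddle 0ℓ → ∀ φ → Valid φ → EqValid (translation φ)
valid⇒translation-valid lem φ valid B = translation-holds lem φ B λ laws →
  let e = Σ-enumeration {P = IsValue B} λ _ → lem
      c₀ = proj₁ (Enumeration.enum-onto e (proj₂ (value-exists laws)))
  in valueStructure B e c₀ , Values.coding laws e c₀ , valid _

finValid⇒translation-finValid : ExcludedMiddle 0ℓ → ∀ φ → FinValid φ → EqFinValid (translation φ)
finValid⇒translation-finValid lem φ valid N r = translation-holds lem φ B model
  where
  B = finStructure N r
  model : Laws (arity φ) B → Σ Structure λ A → Coding (arity φ) A B × ∀ ρ → Sat A ρ φ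
  model laws with fin-enumeration {P = IsValue B} (λ _ → lem)
  ... | suc k , e = valueStructure B e Fin.zero , Values.coding laws e Fin.zero , valid k _
  ... | zero  , e with Enumeration.enum-onto e (proj₂ (value-exists laws))
  ...   | () , _

worlds-translation⇒Sat : ExcludedMiddle 0ℓ → ∀ φ A {W} (T : TupleCode (arity φ) (Carrier A) W) w₀ →
               Holds (Worlds.worlds A T w₀) (translation φ) → ∀ ρ → Sat A ρ φ
worlds-translation⇒Sat lem φ A {W} T w₀ holds ρ = decidable-stable lem λ ¬sat →
  translation-holds⇒¬¬Sat φ coding laws holds w (¬sat ∘ Sat-cong φ agree)
  where
  open Worlds A T w₀
  open TupleCode T
  open Correctness {vars φ} coding using (assignment; slot<)
  w : W
  w = put (ρ ∘ nth (vars φ))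
  agree : ∀ {y} → y ∈ vars φ → assignment w y ≡ ρ y
  agree {y} y∈φ = trans (get-put _ (slot< y)) (cong ρ (nth-indexOf y∈φ))

translation-valid⇒valid : ExcludedMiddle 0ℓ → ∀ φ → EqValid (translation φ) → Valid φ
translation-valid⇒valid lem φ holds A = worlds-translation⇒Sat lem φ A functionTuples (λ _ → point A) (holds _)

translation-finValid⇒finValid : ExcludedMiddle 0ℓ → ∀ φ → EqFinValid (translation φ) → FinValid φ
translation-finValid⇒finValid lem φ holds n r =
  let N , T = finTuples (arity φ) n
  in worlds-translation⇒Sat lem φ (finStructure n r) T Fin.zero (holds N _)

theorem1 : Σ (Formula → Equation) λ f →
    (Σ ℕ λ c → Σ ℕ λ d → (φ : Formula) → esize (f φ) ≤ c * fsize φ + d)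
    × (ExcludedMiddle 0ℓ →
    ((φ : Formula) → (Valid φ ⇔ EqValid (f φ)))
    × ((φ : Formula) → (FinValid φ ⇔ EqFinValid (f φ))))
theorem1 = translation , (101 , 145 , translation-size) , λ lem →
  (λ φ → mk⇔ (valid⇒translation-valid lem φ) (translation-valid⇒valid lem φ)) ,
  (λ φ → mk⇔ (finValid⇒translation-finValid lem φ) (translation-finValid⇒finValid lem φ))
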